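{- The map on inversion sequences given by Algorithm A (described below) is an involution: if $\epsilon$ is an inversion sequence, $\epsilon'$ is the result of applying Algorithm A to $\epsilon$, and $\epsilon''$ is the result of applying Algorithm A to $\epsilon'$, then $\epsilon''=\epsilon$.
   Context: An inversion sequence of length $n$ is an integer sequence with $0\le\epsilon_i<i$ for all $i$. The reduction of an integer word replaces each occurrence of its $k$-th smallest distinct value by $k-1$; a consecutive pattern $\underline{p_1p_2p_3p_4}$ occurs in a sequence at position $i$ if the reduction of its entries in positions $i,\dots,i+3$ equals $p_1p_2p_3p_4$. Let $p=\underline{0102}$ and $q=\underline{0112}$. Algorithm A, on input an integer sequence $\mathrm{seq}=\epsilon_1\cdots\epsilon_n$: let $E_p$, $E_q$ be the sets of positions of occurrences of $p$, resp. $q$, in the input sequence; set $\mathrm{last}:=$ null. For $i=1,2,\dots,n$ in order: let $N_p,N_q$ be the sets of positions of occurrences of $p$, resp. $q$, in the current sequence. If $i-2\in E_p$: set $\mathrm{last}:=\mathrm{seq}[i]$ and $\mathrm{seq}[i]:=\mathrm{seq}[i-1]$. Else if $i-2\in E_q$: set $\mathrm{last}:=\mathrm{seq}[i]$ and $\mathrm{seq}[i]:=\mathrm{seq}[i-2]$. Else if $i-2\in N_p$ or $i-2\in N_q$: swap the values of $\mathrm{seq}[i]$ and $\mathrm{last}$. Output $\mathrm{seq}$. -}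

module Defs where

open import Data.Bool using (if_then_else_; _∨_)
open import Data.Empty using (⊥)
open import Data.Fin using (Fin; toℕ; pred)
open import Data.Integer using (ℤ; +_; _≤_; _<_; _≟_; _<?_)
open import Data.List using (List; []; _∷_; length; map; filter; deduplicate; take; drop; foldl; allFin)
open import Data.List.Properties using (≡-dec)
open import Data.Maybe using (Maybe; just; nothing; _>>=_)
import Data.Maybe as Maybe
open import Data.Nat using (ℕ; zero; suc; _∸_)
import Data.Nat.Properties as ℕ
open import Data.Product using (_×_)
open import Data.Vec using (Vec; lookup; toList; _[_]≔_)
open import Relation.Binary.PropositionalEquality using (_≡_)
open import Relation.Nullary using (Dec; no; does)

-- The entry at index i : Fin n of a sequence of length n is the one that
-- is written ε_(pos i) when entries are numbered from 1.
pos : ∀ {n} → Fin n → ℕ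
pos i = suc (toℕ i)

IsInversionSequence : ∀ {n} → Vec ℤ n → Set
IsInversionSequence {n} ε =
  (i : Fin n) → (+ 0 ≤ lookup ε i) × (lookup ε i < + pos i)

-- If x is the k-th smallest distinct value of w, then exactly k − 1
-- distinct values of w are smaller than x.
reduction : List ℤ → List ℕ
reduction w = map (λ x → length (filter (_<? x) (deduplicate _≟_ w))) w

Pattern : Set
Pattern = List ℕ

-- Positions are numbered from 1, so nothing occurs at 0.  Near the end of
-- the sequence the window is shorter than π, hence its reduction is not π.
OccursAt : ∀ {n} → Pattern → Vec ℤ n → ℕ → Set
OccursAt π ε zero    = ⊥
OccursAt π ε (suc j) = reduction (take (length π) (drop j (toList ε))) ≡ π

occursAt? : ∀ {n} (π : Pattern) (ε : Vec ℤ n) (j : ℕ) → Dec (OccursAt π ε j)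
occursAt? π ε zero    = no λ ()
occursAt? π ε (suc j) = ≡-dec ℕ._≟_ _ π

p q : Pattern
p = 0 ∷ 1 ∷ 0 ∷ 2 ∷ []
q = 0 ∷ 1 ∷ 1 ∷ 2 ∷ []

-- last is nothing while it is null.
record State (n : ℕ) : Set where
  constructor ⟨_,_⟩
  field
    seq  : Vec ℤ n
    last : Maybe ℤ

-- Swapping with a null last would not leave an integer sequence; the
-- algorithm is then taken to fail.
swapLast : ∀ {n} → Fin n → State n → Maybe (State n)
swapLast i ⟨ seq , nothing ⟩ = nothing
swapLast i ⟨ seq , just x  ⟩ = just ⟨ seq [ i ]≔ x , just (lookup seq i) ⟩

-- One iteration of the loop, on input sequence ε.  Since pos i ∸ 2 is 0 for
-- pos i ≤ 2, the conditions are false there; in particular pred i and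
-- pred (pred i) are only used when they are the one and two places
-- preceding i.
step : ∀ {n} → Vec ℤ n → Fin n → State n → Maybe (State n)
step ε i s@(⟨ seq , last ⟩) =
  if does (occursAt? p ε (pos i ∸ 2)) then
    just ⟨ seq [ i ]≔ lookup seq (pred i) , just (lookup seq i) ⟩
  else if does (occursAt? q ε (pos i ∸ 2)) then
    just ⟨ seq [ i ]≔ lookup seq (pred (pred i)) , just (lookup seq i) ⟩
  else if does (occursAt? p seq (pos i ∸ 2)) ∨ does (occursAt? q seq (pos i ∸ 2)) then
    swapLast i s
  else
    just s

algorithmA : ∀ {n} → Vec ℤ n → Maybe (Vec ℤ n)
algorithmA {n} ε =
  Maybe.map State.seq
    (foldl (λ ms i → ms >>= step ε i) (just ⟨ ε , nothing ⟩) (allFin n))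

{-# OPTIONS --safe #-}
-- Call an index active if one of the first three branches is taken there.  The
-- value before and the value after such a step are both at most the preceding
-- entry and below the following one, whereas a window matching p or q has an
-- ascent just before its third entry; so active indices are never adjacent.
-- Hence the output is determined by the input through a condition on each
-- window, and this condition turns out to be symmetric in input and output:
-- the first two branches exchange their roles, and the third is its own inverse.
module Submission where

open import Defs
open import Data.Bool using (true; false)
open import Data.Empty using (⊥-elim)
open import Data.Fin using (Fin; toℕ; pred)
import Data.Fin as Fin
import Data.Fin.Properties as Fin
open import Data.Nat using (ℕ; zero; suc; _∸_; z≤n; s≤s)
import Data.Nat as ℕ
import Data.Nat.Properties as ℕ
open import Data.Integer using (ℤ; +_; -1ℤ; _≤_; _<_; _≟_; _<?_; -≤+; +≤+)
open import Data.Integer.Properties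
open import Data.List using (List; []; _∷_; length; filter; deduplicate; take; drop; foldl)
import Data.List as List
open import Data.List.Properties using (length-map)
open import Data.List.Membership.Propositional using (_∈_)
open import Data.List.Membership.Propositional.Properties using (∈-deduplicate⁺)
open import Data.List.Relation.Unary.Any using (here; there)
open import Data.Vec using (Vec; []; _∷_; lookup; toList; tabulate; _[_]≔_)
open import Data.Vec.Properties using (lookup∘tabulate)
open import Data.Maybe using (Maybe; just; nothing; _>>=_)
import Data.Maybe as Maybe
open import Data.Product using (_×_; _,_; proj₁; proj₂; ∃-syntax)
open import Data.Sum using (_⊎_; inj₁; inj₂; [_,_]′)
open import Data.Unit using (⊤; tt)
open import Function using (_∘_; id)
open import Relation.Binary.Definitions using (tri<; tri≈; tri>)
open import Relation.Binary.PropositionalEquality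
  using (_≡_; _≢_; refl; sym; trans; cong; cong₂; subst; subst₂)
open import Relation.Nullary using (¬_; Dec; yes; no; does; contradiction)
open import Relation.Nullary.Decidable using (_×-dec_; _⊎-dec_; dec-true; dec-false)

-- Windows of four integers matching a pattern

Sequence : Set
Sequence = ℕ → ℤ

Matches-p Matches-q Matches : ℤ → ℤ → ℤ → ℤ → Set
Matches-p a b c d = a ≡ c × a < b × b < d
Matches-q a b c d = b ≡ c × a < b × b < d
Matches a b c d = Matches-p a b c d ⊎ Matches-q a b c d

matches-p? : ∀ a b c d → Dec (Matches-p a b c d)
matches-p? a b c d = a ≟ c ×-dec a <? b ×-dec b <? d

matches-q? : ∀ a b c d → Dec (Matches-q a b c d)
matches-q? a b c d = b ≟ c ×-dec a <? b ×-dec b <? d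

matches? : ∀ a b c d → Dec (Matches a b c d)
matches? a b c d = matches-p? a b c d ⊎-dec matches-q? a b c d

matches-ascent : ∀ {a b c d} → Matches a b c d → a < b
matches-ascent (inj₁ (_ , a<b , _)) = a<b
matches-ascent (inj₂ (_ , a<b , _)) = a<b

matches-top : ∀ {a b c d} → Matches a b c d → b < d
matches-top (inj₁ (_ , _ , b<d)) = b<d
matches-top (inj₂ (_ , _ , b<d)) = b<d

matches-third<last : ∀ {a b c d} → Matches a b c d → c < d
matches-third<last (inj₁ (refl , a<b , b<d)) = <-trans a<b b<d
matches-third<last (inj₂ (refl , _ , b<d))   = b<d

-- Reductions and ranks

countBelow : List ℤ → ℤ → ℕ
countBelow w x = length (filter (_<? x) w)

countBelow-mono : ∀ w {x y} → x ≤ y → countBelow w x ℕ.≤ countBelow w y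
countBelow-mono [] x≤y = z≤n
countBelow-mono (z ∷ w) {x} {y} x≤y with z <? x | z <? y
... | yes _   | yes _   = s≤s (countBelow-mono w x≤y)
... | yes z<x | no z≮y  = contradiction (<-≤-trans z<x x≤y) z≮y
... | no _    | yes _   = ℕ.m≤n⇒m≤1+n (countBelow-mono w x≤y)
... | no _    | no _    = countBelow-mono w x≤y

-- The entry `x` itself is counted below `y` but not below `x`.
countBelow-strict : ∀ {w x y} → x ∈ w → x < y → countBelow w x ℕ.< countBelow w y
countBelow-strict {z ∷ w} {x} {y} x∈ x<y with z <? x | z <? y
countBelow-strict (here refl) x<y | yes z<x | _     = contradiction z<x (<-irrefl refl)
countBelow-strict {_ ∷ w} (here refl) x<y | no _ | yes _ = s≤s (countBelow-mono w (<⇒≤ x<y))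
countBelow-strict (here refl) x<y | no _ | no z≮y   = contradiction x<y z≮y
countBelow-strict (there x∈) x<y | yes _ | yes _    = s≤s (countBelow-strict x∈ x<y)
countBelow-strict (there x∈) x<y | yes z<x | no z≮y = contradiction (<-trans z<x x<y) z≮y
countBelow-strict (there x∈) x<y | no _ | yes _     = ℕ.m≤n⇒m≤1+n (countBelow-strict x∈ x<y)
countBelow-strict (there x∈) x<y | no _ | no _      = countBelow-strict x∈ x<y

-- Chosen so that `reduction w` is `map (rank w) w` by definition.
rank : List ℤ → ℤ → ℕ
rank w = countBelow (deduplicate _≟_ w)

rank-cancel-< : ∀ w {x y} → rank w x ℕ.< rank w y → x < y
rank-cancel-< w {x} {y} r<r with x <? y
... | yes x<y = x<y
... | no x≮y  =
  contradiction r<r (ℕ.≤⇒≯ (countBelow-mono (deduplicate _≟_ w) (≮⇒≥ x≮y)))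

rank-injective : ∀ {w x y} → x ∈ w → y ∈ w → rank w x ≡ rank w y → x ≡ y
rank-injective {w} {x} {y} x∈ y∈ r≡r with <-cmp x y
... | tri< x<y _ _ =
  contradiction r≡r (ℕ.<⇒≢ (countBelow-strict (∈-deduplicate⁺ _≟_ x∈) x<y))
... | tri≈ _ x≡y _ = x≡y
... | tri> _ _ y<x =
  contradiction (sym r≡r) (ℕ.<⇒≢ (countBelow-strict (∈-deduplicate⁺ _≟_ y∈) y<x))

∷-equalities : ∀ {a b c d a′ b′ c′ d′ : ℕ} →
  _≡_ {A = List ℕ} (a ∷ b ∷ c ∷ d ∷ []) (a′ ∷ b′ ∷ c′ ∷ d′ ∷ []) →
  a ≡ a′ × b ≡ b′ × c ≡ c′ × d ≡ d′
∷-equalities refl = refl , refl , refl , refl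

reduction-p⇒ : ∀ {a b c d} → reduction (a ∷ b ∷ c ∷ d ∷ []) ≡ p → Matches-p a b c d
reduction-p⇒ {a} {b} {c} {d} eq =
  let w = a ∷ b ∷ c ∷ d ∷ []
      ra , rb , rc , rd = ∷-equalities eq
  in rank-injective {w} (here refl) (there (there (here refl))) (trans ra (sym rc))
   , rank-cancel-< w (subst₂ ℕ._<_ (sym ra) (sym rb) (s≤s z≤n))
   , rank-cancel-< w (subst₂ ℕ._<_ (sym rb) (sym rd) (s≤s (s≤s z≤n)))

reduction-q⇒ : ∀ {a b c d} → reduction (a ∷ b ∷ c ∷ d ∷ []) ≡ q → Matches-q a b c d
reduction-q⇒ {a} {b} {c} {d} eq =
  let w = a ∷ b ∷ c ∷ d ∷ []
      ra , rb , rc , rd = ∷-equalities eq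
  in rank-injective {w} (there (here refl)) (there (there (here refl))) (trans rb (sym rc))
   , rank-cancel-< w (subst₂ ℕ._<_ (sym ra) (sym rb) (s≤s z≤n))
   , rank-cancel-< w (subst₂ ℕ._<_ (sym rb) (sym rd) (s≤s (s≤s z≤n)))

module _ {a b d} (a<b : a < b) (b<d : b < d) where

  private
    a<d = <-trans a<b b<d

    ≟-refl : ∀ x → does (x ≟ x) ≡ true
    ≟-refl x = dec-true (x ≟ x) refl

    ≟-< : ∀ {x y} → x < y → does (x ≟ y) ≡ false
    ≟-< {x} {y} x<y = dec-false (x ≟ y) (<⇒≢ x<y)

    ≟-> : ∀ {x y} → y < x → does (x ≟ y) ≡ false
    ≟-> {x} {y} y<x = dec-false (x ≟ y) (<⇒≢ y<x ∘ sym)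

    <?-< : ∀ {x y} → x < y → does (x <? y) ≡ true
    <?-< {x} {y} = dec-true (x <? y)

    <?-> : ∀ {x y} → y < x → does (x <? y) ≡ false
    <?-> {x} {y} y<x = dec-false (x <? y) (<-asym y<x)

    <?-irrefl : ∀ x → does (x <? x) ≡ false
    <?-irrefl x = dec-false (x <? x) (<-irrefl refl)

  reduction-0102 : reduction (a ∷ b ∷ a ∷ d ∷ []) ≡ p
  reduction-0102
    -- The first row settles the equality tests made by `deduplicate`, the others the comparisons
    -- counted by `filter`; after that the reduction computes.
    rewrite ≟-< a<d | ≟-> a<b | ≟-< b<d | ≟-< a<b | ≟-refl a | ≟-< a<d
          | <?-irrefl a | <?-> a<b | <?-> a<d | <?-< a<b | <?-irrefl b | <?-> b<d
          | <?-< a<d | <?-< b<d | <?-irrefl d = refl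

  reduction-0112 : reduction (a ∷ b ∷ b ∷ d ∷ []) ≡ q
  reduction-0112
    rewrite ≟-< b<d | ≟-refl b | ≟-< b<d | ≟-< a<b | ≟-< a<d
          | <?-irrefl a | <?-> a<b | <?-> a<d | <?-< a<b | <?-irrefl b | <?-> b<d
          | <?-< a<d | <?-< b<d | <?-irrefl d = refl

-- Vectors as padded sequences, and occurrences as matches

-- Padding with −1, which is below all entries of an inversion sequence, rules
-- out matches that extend beyond the end.
entry : ∀ {n} → Vec ℤ n → Sequence
entry []      _       = -1ℤ
entry (x ∷ v) zero    = x
entry (x ∷ v) (suc k) = entry v k

entry-lookup : ∀ {n} (v : Vec ℤ n) i → entry v (toℕ i) ≡ lookup v i
entry-lookup (x ∷ v) Fin.zero    = refl
entry-lookup (x ∷ v) (Fin.suc i) = entry-lookup v i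

entry-beyond : ∀ {n} (v : Vec ℤ n) {k} → n ℕ.≤ k → entry v k ≡ -1ℤ
entry-beyond []      _         = refl
entry-beyond (x ∷ v) (s≤s n≤k) = entry-beyond v n≤k

entry-update : ∀ {n} (v : Vec ℤ n) i x → entry (v [ i ]≔ x) (toℕ i) ≡ x
entry-update (_ ∷ v) Fin.zero    x = refl
entry-update (_ ∷ v) (Fin.suc i) x = entry-update v i x

entry-minimal : ∀ {n} (v : Vec ℤ n) i x {k} → k ≢ toℕ i → entry (v [ i ]≔ x) k ≡ entry v k
entry-minimal (_ ∷ v) Fin.zero    x {zero}  k≢i = contradiction refl k≢i
entry-minimal (_ ∷ v) Fin.zero    x {suc k} k≢i = refl
entry-minimal (_ ∷ v) (Fin.suc i) x {zero}  k≢i = refl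
entry-minimal (_ ∷ v) (Fin.suc i) x {suc k} k≢i = entry-minimal v i x (k≢i ∘ cong suc)

entry-injective : ∀ {n} (u v : Vec ℤ n) → (∀ k → entry u k ≡ entry v k) → u ≡ v
entry-injective []      []      eq = refl
entry-injective (x ∷ u) (y ∷ v) eq = cong₂ _∷_ (eq 0) (entry-injective u v (eq ∘ suc))

window : ∀ {n} → Vec ℤ n → ℕ → List ℤ
window v j = take 4 (drop j (toList v))

-- For a window running over the end, the wrong length rules out an occurrence, and the padding
-- rules out a match, whose last entry exceeds another one.
window-entries : ∀ {n} (v : Vec ℤ n) j →
  window v j ≡ entry v j ∷ entry v (1 ℕ.+ j) ∷ entry v (2 ℕ.+ j) ∷ entry v (3 ℕ.+ j) ∷ []
  ⊎ length (window v j) ≢ 4 × entry v (3 ℕ.+ j) ≡ -1ℤ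
window-entries []                      zero    = inj₂ ((λ ()) , refl)
window-entries (_ ∷ [])                zero    = inj₂ ((λ ()) , refl)
window-entries (_ ∷ _ ∷ [])            zero    = inj₂ ((λ ()) , refl)
window-entries (_ ∷ _ ∷ _ ∷ [])        zero    = inj₂ ((λ ()) , refl)
window-entries (_ ∷ _ ∷ _ ∷ _ ∷ _)     zero    = inj₁ refl
window-entries []                      (suc j) = inj₂ ((λ ()) , refl)
window-entries (x ∷ v)                 (suc j) = window-entries v j

reduction-length : ∀ w {π} → reduction w ≡ π → length w ≡ length π
reduction-length w refl = sym (length-map _ w)

module _ {n} (v : Vec ℤ n) (j : ℕ) where

  MatchesAt-p MatchesAt-q : Set
  MatchesAt-p = Matches-p (entry v j) (entry v (1 ℕ.+ j)) (entry v (2 ℕ.+ j)) (entry v (3 ℕ.+ j))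
  MatchesAt-q = Matches-q (entry v j) (entry v (1 ℕ.+ j)) (entry v (2 ℕ.+ j)) (entry v (3 ℕ.+ j))

  occurs-p⇒ : OccursAt p v (suc j) → MatchesAt-p
  occurs-p⇒ o with window-entries v j
  ... | inj₁ eq        = reduction-p⇒ (subst (λ w → reduction w ≡ p) eq o)
  ... | inj₂ (≢4 , _)  = contradiction (reduction-length (window v j) o) ≢4

  occurs-q⇒ : OccursAt q v (suc j) → MatchesAt-q
  occurs-q⇒ o with window-entries v j
  ... | inj₁ eq        = reduction-q⇒ (subst (λ w → reduction w ≡ q) eq o)
  ... | inj₂ (≢4 , _)  = contradiction (reduction-length (window v j) o) ≢4

  module _ (-1≤ : ∀ k → -1ℤ ≤ entry v k) where

    private
      not-padding : ∀ {k} → entry v k < entry v (3 ℕ.+ j) → entry v (3 ℕ.+ j) ≢ -1ℤ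
      not-padding {k} k<last eq = ≤⇒≯ (-1≤ k) (subst (entry v k <_) eq k<last)

    occurs-p⇐ : MatchesAt-p → OccursAt p v (suc j)
    occurs-p⇐ (a≡c , a<b , b<d) with window-entries v j
    ... | inj₂ (_ , eq) = ⊥-elim (not-padding b<d eq)
    ... | inj₁ eq rewrite eq | sym a≡c = reduction-0102 a<b b<d

    occurs-q⇐ : MatchesAt-q → OccursAt q v (suc j)
    occurs-q⇐ (b≡c , a<b , b<d) with window-entries v j
    ... | inj₂ (_ , eq) = ⊥-elim (not-padding b<d eq)
    ... | inj₁ eq rewrite eq | sym b≡c = reduction-0112 a<b b<d

-- The local relation between input and output, and its symmetry

-- Active e s k: the algorithm with input e and output s writes at index k, in
-- its first (raise), second (lower) or third (exchange) branch.
mutual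
  data Active (e s : Sequence) : ℕ → Set where
    active : ∀ {j} → e j < e (1 ℕ.+ j) → s j < s (1 ℕ.+ j) → e (1 ℕ.+ j) ≡ s (1 ℕ.+ j) →
      e (1 ℕ.+ j) < e (3 ℕ.+ j) → Change e s j → Active e s (2 ℕ.+ j)

  data Change (e s : Sequence) (j : ℕ) : Set where
    raise    : e (2 ℕ.+ j) ≡ e j → s (2 ℕ.+ j) ≡ s (1 ℕ.+ j) → Change e s j
    lower    : e (2 ℕ.+ j) ≡ e (1 ℕ.+ j) → s (2 ℕ.+ j) ≡ s j → Change e s j
    exchange : Active e s j → e j ≢ s j → e (2 ℕ.+ j) ≡ s j → s (2 ℕ.+ j) ≡ e j → Change e s j

-- The window whose third index is k, read from f before k and from g from k on.
NoMatch : Sequence → Sequence → ℕ → Set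
NoMatch f g (suc (suc j)) = ¬ Matches (f j) (f (1 ℕ.+ j)) (g (2 ℕ.+ j)) (g (3 ℕ.+ j))
NoMatch f g _             = ⊤

-- The two `NoMatch` conditions in `fixed` say that step `k` takes no writing branch: one concerns
-- the input window, the other the current window, whose entries before `k` are already output.
data Local (e s : Sequence) (k : ℕ) : Set where
  changed : Active e s k → Local e s k
  fixed   : e k ≡ s k → NoMatch e e k → NoMatch s e k → Local e s k

Related : Sequence → Sequence → Set
Related e s = ∀ k → Local e s k

module _ {e s : Sequence} where

  -- At an active index `2 + j` each of the two values is the middle entry, `e j` or `s j`, and the
  -- latter two lie below the middle entry by the ascents stored in `active`.
  active-≤ : ∀ {k} → Active e s (suc k) → e (suc k) ≤ e k × s (suc k) ≤ s k
  active-≤ (active a<b a′<b b≡ _ (raise x y)) =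
    ≤-trans (≤-reflexive x) (<⇒≤ a<b) , ≤-reflexive y
  active-≤ (active a<b a′<b b≡ _ (lower x y)) =
    ≤-reflexive x , ≤-trans (≤-reflexive y) (<⇒≤ a′<b)
  active-≤ (active {j} a<b a′<b b≡ _ (exchange _ _ x y)) =
    ≤-trans (≤-reflexive x) (<⇒≤ (subst (s j <_) (sym b≡) a′<b)) ,
    ≤-trans (≤-reflexive y) (<⇒≤ (subst (e j <_) b≡ a<b))

  active-<next : ∀ {k} → Active e s k → e k < e (suc k) × s k < e (suc k)
  active-<next k@(active {j} _ _ b≡ b<d _) =
    let e≤ , s≤ = active-≤ k
    in ≤-<-trans e≤ b<d , ≤-<-trans s≤ (subst (_< e (3 ℕ.+ j)) b≡ b<d)

  active⇒fixed-next : ∀ {k} → Active e s k → ¬ Active e s (suc k)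
  active⇒fixed-next k k+1 = ≤⇒≯ (proj₁ (active-≤ k+1)) (proj₁ (active-<next k))

  fixed-equal : ∀ {k} → Local e s k → ¬ Active e s k → e k ≡ s k
  fixed-equal (changed a)   ¬a = contradiction a ¬a
  fixed-equal (fixed eq _ _) _ = eq

  -- `raise` and `lower` exhibit `p` and `q` in the input window, `exchange` exhibits `p` in the
  -- window that starts with output entries.
  active-not-fixed : ∀ {k} → Active e s k → NoMatch e e k → ¬ NoMatch s e k
  active-not-fixed (active a<b _ _ b<d (raise x _)) ne _ = ne (inj₁ (sym x , a<b , b<d))
  active-not-fixed (active a<b _ _ b<d (lower x _)) ne _ = ne (inj₂ (sym x , a<b , b<d))
  active-not-fixed (active {j} _ a′<b b≡ b<d (exchange _ _ x _)) _ ns =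
    ns (inj₁ (sym x , a′<b , subst (_< e (3 ℕ.+ j)) b≡ b<d))

module _ {e s : Sequence} (R : Related e s) where

  active-sym : ∀ {k} → Active e s k → Active s e k
  active-sym k@(active {j} a<b a′<b b≡ b<d c) =
    active a′<b a<b (sym b≡) (subst₂ _<_ b≡ d≡ b<d) (change-sym c)
    where
    -- Active indices are never adjacent, so the last entry of the window is common to input and
    -- output.
    d≡ : e (3 ℕ.+ j) ≡ s (3 ℕ.+ j)
    d≡ = fixed-equal (R (3 ℕ.+ j)) (active⇒fixed-next k)

    change-sym : Change e s j → Change s e j
    change-sym (raise x y)         = lower y x
    change-sym (lower x y)         = raise y x
    change-sym (exchange a a≢ x y) = exchange (active-sym a) (a≢ ∘ sym) y x

  -- If the last entry of the window is changed, it does not exceed the third one.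
  noMatch-output : ∀ {f k} → e k ≡ s k → NoMatch f e k → NoMatch f s k
  noMatch-output {k = 0} _ _ = tt
  noMatch-output {k = 1} _ _ = tt
  noMatch-output {f} {suc (suc j)} c≡ ne m with R (3 ℕ.+ j)
  ... | changed a      = ≤⇒≯ (proj₂ (active-≤ a)) (matches-third<last m)
  ... | fixed d≡ _ _   = ne (subst₂ (Matches (f j) (f (1 ℕ.+ j))) (sym c≡) (sym d≡) m)

  related-sym : Related s e
  related-sym k with R k
  ... | changed a      = changed (active-sym a)
  ... | fixed k≡ ne ns =
    -- The conditions cross over: the mixed window of the first run yields the input window of the
    -- second, and conversely.
    fixed (sym k≡) (noMatch-output {s} {k} k≡ ns) (noMatch-output {e} {k} k≡ ne)

  -- Upper bounds in an inversion sequence grow with the index, so values taken from the same or an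
  -- earlier index keep the output an inversion sequence.
  output-from-input : ∀ k → ∃[ m ] (m ℕ.≤ k × s k ≡ e m)
  output-from-input k with R k
  ... | fixed k≡ _ _ = k , ℕ.≤-refl , sym k≡
  ... | changed (active {j} _ _ b≡ _ (raise _ y)) =
    1 ℕ.+ j , ℕ.n≤1+n _ , trans y (sym b≡)
  ... | changed (active {j} _ _ _ _ (lower _ y)) =
    let m , m≤j , eq = output-from-input j
    in m , ℕ.≤-trans m≤j (ℕ.m≤n+m j 2) , trans y eq
  ... | changed (active {j} _ _ _ _ (exchange _ _ _ y)) =
    j , ℕ.m≤n+m j 2 , y

-- A recursive description of the output

choose : ∀ {A B C : Set} → Dec A → Dec B → Dec C → (x y z w : ℤ) → ℤ
choose (yes _) _       _       x y z w = x
choose (no _)  (yes _) _       x y z w = y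
choose (no _)  (no _)  (yes _) x y z w = z
choose (no _)  (no _)  (no _)  x y z w = w

-- There is no `last` here: the third branch writes `e j`, the input entry two places back, which is
-- what `last` holds when the algorithm swaps.
transform : Sequence → Sequence
transform e 0 = e 0
transform e 1 = e 1
transform e (suc k@(suc j)) =
  choose (matches-p? (e j) (e k) (e (2 ℕ.+ j)) (e (3 ℕ.+ j)))
    (matches-q? (e j) (e k) (e (2 ℕ.+ j)) (e (3 ℕ.+ j)))
    (matches? (transform e j) (transform e k) (e (2 ℕ.+ j)) (e (3 ℕ.+ j)))
    (transform e k) (transform e j) (e j) (e (2 ℕ.+ j))

module _ (e : Sequence) where

  private
    s = transform e

  output<middle : ∀ {j} → Local e s j → e j < e (1 ℕ.+ j) → s j < e (1 ℕ.+ j)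
  output<middle (changed a)    _   = proj₂ (active-<next a)
  output<middle {j} (fixed j≡ _ _) a<b = subst (_< e (1 ℕ.+ j)) j≡ a<b

  -- By `active-≤`, no ascent of the input or of the output leads into an active index.
  fixed-middle : ∀ {j} → Local e s (1 ℕ.+ j) → e j < e (1 ℕ.+ j) ⊎ s j < s (1 ℕ.+ j) →
    e (1 ℕ.+ j) ≡ s (1 ℕ.+ j)
  fixed-middle L ascent = fixed-equal L λ a →
    [ ≤⇒≯ (proj₁ (active-≤ a)) , ≤⇒≯ (proj₂ (active-≤ a)) ]′ ascent

  transform-related : Related e s
  transform-related 0 = fixed refl tt tt
  transform-related 1 = fixed refl tt tt
  transform-related (suc k@(suc j))
    with matches-p? (e j) (e k) (e (2 ℕ.+ j)) (e (3 ℕ.+ j)) in eq₁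
       | matches-q? (e j) (e k) (e (2 ℕ.+ j)) (e (3 ℕ.+ j)) in eq₂
       | matches? (s j) (s k) (e (2 ℕ.+ j)) (e (3 ℕ.+ j)) in eq₃
       | transform-related j | transform-related k
  ... | yes (a≡c , a<b , b<d) | _ | _ | Lj | Lk =
    changed (active a<b (subst (s j <_) b≡ (output<middle Lj a<b)) b≡ b<d
      (raise (sym a≡c) s≡))
    where
    b≡ = fixed-middle Lk (inj₁ a<b)
    s≡ : s (suc k) ≡ s k
    s≡ rewrite eq₁ = refl
  ... | no _ | yes (b≡c , a<b , b<d) | _ | Lj | Lk =
    changed (active a<b (subst (s j <_) b≡ (output<middle Lj a<b)) b≡ b<d
      (lower (sym b≡c) s≡))
    where
    b≡ = fixed-middle Lk (inj₁ a<b)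
    s≡ : s (suc k) ≡ s j
    s≡ rewrite eq₁ | eq₂ = refl
  ... | no ¬p | no ¬q | yes m | Lj | Lk = go Lj m
    where
    c = e (2 ℕ.+ j)
    d = e (3 ℕ.+ j)
    b≡ = fixed-middle Lk (inj₂ (matches-ascent m))
    m′ : Matches (s j) (e k) c d
    m′ = subst (λ b → Matches (s j) b c d) (sym b≡) m
    s≡ : s (suc k) ≡ e j
    s≡ rewrite eq₁ | eq₂ | eq₃ = refl
    go : Local e s j → Matches (s j) (s k) c d → Local e s (suc k)
    -- If index `j` is unchanged, the mixed window is the input window, which has failed both tests.
    go (fixed a≡ _ _) _ =
      contradiction (subst (λ a → Matches a (e k) c d) (sym a≡) m′) [ ¬p , ¬q ]′
    -- If `e j` were equal to `s j`, the input window would match `p`.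
    go (changed a) (inj₁ (a′≡c , a′<b , b<d)) =
      changed (active a<b a′<b b≡ (matches-top m′)
        (exchange a (λ a≡a′ → ¬p (trans a≡a′ a′≡c , a<b , matches-top m′)) (sym a′≡c) s≡))
      where a<b = proj₁ (active-<next a)
    -- The middle entry is unchanged, so a match of `q` here would be one in the input already; a
    -- swap can only come from `p`.
    go (changed a) (inj₂ (b≡c , _ , b<d)) =
      contradiction (trans b≡ b≡c , proj₁ (active-<next a) , matches-top m′) ¬q
  ... | no ¬p | no ¬q | no ¬m | _ | _ = fixed (sym s≡) [ ¬p , ¬q ]′ ¬m
    where
    s≡ : s (suc k) ≡ e (suc k)
    s≡ rewrite eq₁ | eq₂ | eq₃ = refl

-- Single steps and the loop invariant

toℕ-pred : ∀ {n} (i : Fin n) → toℕ (pred i) ≡ toℕ i ∸ 1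
toℕ-pred Fin.zero    = refl
toℕ-pred (Fin.suc i) = Fin.toℕ-inject₁ i

-- Taking `f` to be the output and `g` the input describes the current sequence before step `k`;
-- taking both to be the input lets the same lemmas serve the tests on the input.
record Agrees {n} (v : Vec ℤ n) (f g : Sequence) (k : ℕ) : Set where
  constructor agrees
  field
    before : ∀ {m} → m ℕ.< k → entry v m ≡ f m
    after  : ∀ {m} → k ℕ.≤ m → entry v m ≡ g m

open Agrees

module _ {n} {v : Vec ℤ n} {f g : Sequence} {i : Fin n} where

  agrees-noMatch : ∀ {k} → toℕ i ≡ k → Agrees v f g k → NoMatch f g k →
    ¬ OccursAt p v (pos i ∸ 2) × ¬ OccursAt q v (pos i ∸ 2)
  -- At indices 0 and 1, `pos i ∸ 2` is 0, where nothing occurs; at index `2 + j` it is `suc j`, the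
  -- position of index `j`.
  agrees-noMatch {0} i≡ A _ rewrite i≡ = (λ ()) , (λ ())
  agrees-noMatch {1} i≡ A _ rewrite i≡ = (λ ()) , (λ ())
  agrees-noMatch {suc (suc j)} i≡ A none
    rewrite i≡
          | sym (before A {j} (s≤s (ℕ.n≤1+n j))) | sym (before A {suc j} ℕ.≤-refl)
          | sym (after A {2 ℕ.+ j} ℕ.≤-refl) | sym (after A {3 ℕ.+ j} (ℕ.n≤1+n _)) =
    none ∘ inj₁ ∘ occurs-p⇒ v j , none ∘ inj₂ ∘ occurs-q⇒ v j

  module _ (-1≤f : ∀ m → -1ℤ ≤ f m) (-1≤g : ∀ m → -1ℤ ≤ g m) where

    agrees-≥-1 : ∀ {k} → Agrees v f g k → ∀ m → -1ℤ ≤ entry v m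
    agrees-≥-1 {k} A m with m ℕ.<? k
    ... | yes m<k = ≤-trans (-1≤f m) (≤-reflexive (sym (before A m<k)))
    ... | no m≮k  = ≤-trans (-1≤g m) (≤-reflexive (sym (after A (ℕ.≮⇒≥ m≮k))))

    agrees-p : ∀ {j} → toℕ i ≡ 2 ℕ.+ j → Agrees v f g (2 ℕ.+ j) →
      Matches-p (f j) (f (1 ℕ.+ j)) (g (2 ℕ.+ j)) (g (3 ℕ.+ j)) → OccursAt p v (pos i ∸ 2)
    agrees-p {j} i≡ A m
      rewrite i≡
            | sym (before A {j} (s≤s (ℕ.n≤1+n j))) | sym (before A {suc j} ℕ.≤-refl)
            | sym (after A {2 ℕ.+ j} ℕ.≤-refl) | sym (after A {3 ℕ.+ j} (ℕ.n≤1+n _)) =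
      occurs-p⇐ v j (agrees-≥-1 A) m

    agrees-q : ∀ {j} → toℕ i ≡ 2 ℕ.+ j → Agrees v f g (2 ℕ.+ j) →
      Matches-q (f j) (f (1 ℕ.+ j)) (g (2 ℕ.+ j)) (g (3 ℕ.+ j)) → OccursAt q v (pos i ∸ 2)
    agrees-q {j} i≡ A m
      rewrite i≡
            | sym (before A {j} (s≤s (ℕ.n≤1+n j))) | sym (before A {suc j} ℕ.≤-refl)
            | sym (after A {2 ℕ.+ j} ℕ.≤-refl) | sym (after A {3 ℕ.+ j} (ℕ.n≤1+n _)) =
      occurs-q⇐ v j (agrees-≥-1 A) m

module _ {n} {ε : Vec ℤ n} {i : Fin n} {seq : Vec ℤ n} {last : Maybe ℤ} where

  private
    j = pos i ∸ 2

  step-p : OccursAt p ε j →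
    step ε i ⟨ seq , last ⟩ ≡ just ⟨ seq [ i ]≔ lookup seq (pred i) , just (lookup seq i) ⟩
  step-p o rewrite dec-true (occursAt? p ε j) o = refl

  step-q : ¬ OccursAt p ε j → OccursAt q ε j →
    step ε i ⟨ seq , last ⟩ ≡ just ⟨ seq [ i ]≔ lookup seq (pred (pred i)) , just (lookup seq i) ⟩
  step-q ¬o o rewrite dec-false (occursAt? p ε j) ¬o | dec-true (occursAt? q ε j) o = refl

  step-swap : ∀ {x} → ¬ OccursAt p ε j → ¬ OccursAt q ε j → OccursAt p seq j → last ≡ just x →
    step ε i ⟨ seq , last ⟩ ≡ just ⟨ seq [ i ]≔ x , just (lookup seq i) ⟩
  step-swap ¬o ¬o′ o refl
    rewrite dec-false (occursAt? p ε j) ¬o | dec-false (occursAt? q ε j) ¬o′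
          | dec-true (occursAt? p seq j) o = refl

  step-skip : ¬ OccursAt p ε j → ¬ OccursAt q ε j → ¬ OccursAt p seq j → ¬ OccursAt q seq j →
    step ε i ⟨ seq , last ⟩ ≡ just ⟨ seq , last ⟩
  step-skip ¬o ¬o′ ¬o″ ¬o‴
    rewrite dec-false (occursAt? p ε j) ¬o | dec-false (occursAt? q ε j) ¬o′
          | dec-false (occursAt? p seq j) ¬o″ | dec-false (occursAt? q seq j) ¬o‴ = refl

-- Preservation includes that each step succeeds, so the fold never reaches `nothing`. The general
-- `f` lets the induction pass to `f ∘ Fin.suc`.
foldl-invariant : ∀ {A S : Set} {m} (P : ℕ → S → Set) (next : A → S → Maybe S) (f : Fin m → A) →
  (∀ i {st} → P (toℕ i) st → ∃[ st′ ] (next (f i) st ≡ just st′ × P (suc (toℕ i)) st′)) →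
  ∀ {st} → P 0 st →
  ∃[ st′ ] (foldl (λ ms i → ms >>= next i) (just st) (List.tabulate f) ≡ just st′ × P m st′)
foldl-invariant {m = zero}  P next f pres P₀ = _ , refl , P₀
foldl-invariant {m = suc m} P next f pres P₀ with pres Fin.zero P₀
... | st₁ , eq , P₁ rewrite eq = foldl-invariant (P ∘ suc) next (f ∘ Fin.suc) (pres ∘ Fin.suc) P₁

module _ {e s : Sequence} (R : Related e s)
  (-1≤e : ∀ k → -1ℤ ≤ e k) (-1≤s : ∀ k → -1ℤ ≤ s k) where

  record Invariant {n} (k : ℕ) (st : State n) : Set where
    constructor invariant
    open State st
    field
      current    : Agrees seq s e k
      -- Active positions are never adjacent, so last is still the input value at
      -- position k − 2 when step k swaps.
      remembered : ∀ {j} → j ℕ.< k → k ℕ.≤ 2 ℕ.+ j → Active e s j → last ≡ just (e j)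

  open Invariant

  invariant-write : ∀ {n k x seq last} {i : Fin n} → toℕ i ≡ k → Active e s k → x ≡ s k →
    Invariant k ⟨ seq , last ⟩ → Invariant (suc k) ⟨ seq [ i ]≔ x , just (lookup seq i) ⟩
  invariant-write {x = x} {seq} {i = i} refl a x≡ I = invariant (agrees bef aft) rem
    where
    k = toℕ i
    bef : ∀ {m} → m ℕ.< suc k → entry (seq [ i ]≔ x) m ≡ s m
    bef {m} m<1+k with m ℕ.≟ k
    ... | yes refl = trans (entry-update seq i x) x≡
    ... | no m≢k   = trans (entry-minimal seq i x m≢k)
                       (before (current I) (ℕ.≤∧≢⇒< (ℕ.s≤s⁻¹ m<1+k) m≢k))
    aft : ∀ {m} → suc k ℕ.≤ m → entry (seq [ i ]≔ x) m ≡ e m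
    aft k<m = trans (entry-minimal seq i x (ℕ.<⇒≢ k<m ∘ sym)) (after (current I) (ℕ.<⇒≤ k<m))
    rem : ∀ {j} → j ℕ.< suc k → suc k ℕ.≤ 2 ℕ.+ j → Active e s j → just (lookup seq i) ≡ just (e j)
    -- Either `j` is `k − 1`, impossible since active indices are not adjacent, or `j` is `k`, where
    -- the overwritten value is still the input entry.
    rem {j} (s≤s j≤k) (s≤s k≤1+j) a′ with ℕ.m≤n⇒m<n∨m≡n k≤1+j
    ... | inj₂ k≡1+j = contradiction (subst (Active e s) k≡1+j a) (active⇒fixed-next a′)
    ... | inj₁ (s≤s k≤j) with refl ← ℕ.≤-antisym j≤k k≤j =
      cong just (trans (sym (entry-lookup seq i)) (after (current I) ℕ.≤-refl))

  invariant-skip : ∀ {n k} {st : State n} → e k ≡ s k → ¬ Active e s k →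
    Invariant k st → Invariant (suc k) st
  invariant-skip {k = k} {st} k≡ ¬a I = invariant (agrees bef (after (current I) ∘ ℕ.<⇒≤)) rem
    where
    open State st
    bef : ∀ {m} → m ℕ.< suc k → entry seq m ≡ s m
    bef {m} (s≤s m≤k) with ℕ.m≤n⇒m<n∨m≡n m≤k
    ... | inj₁ m<k  = before (current I) m<k
    ... | inj₂ refl = trans (after (current I) ℕ.≤-refl) k≡
    rem : ∀ {j} → j ℕ.< suc k → suc k ℕ.≤ 2 ℕ.+ j → Active e s j → last ≡ just (e j)
    rem (s≤s j≤k) 1+k≤ a with ℕ.m≤n⇒m<n∨m≡n j≤k
    ... | inj₁ j<k  = remembered I j<k (ℕ.<⇒≤ 1+k≤) a
    ... | inj₂ refl = contradiction a ¬a

  module _ {n} {ε : Vec ℤ n} (ε≗e : ∀ k → entry ε k ≡ e k) where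

    step-invariant : ∀ (i : Fin n) {k st} → toℕ i ≡ k → Invariant k st →
      ∃[ st′ ] (step ε i st ≡ just st′ × Invariant (suc k) st′)
    step-invariant i {k} {st = ⟨ seq , last ⟩} i≡ I with R k
    ... | fixed k≡ ne ns =
      let ¬p , ¬q = agrees-noMatch {i = i} i≡ (agrees (λ _ → ε≗e _) (λ _ → ε≗e _)) ne
          ¬p′ , ¬q′ = agrees-noMatch {i = i} i≡ (current I) ns
      in _ , step-skip {i = i} ¬p ¬q ¬p′ ¬q′
           , invariant-skip k≡ (λ a → active-not-fixed a ne ns) I
    ... | changed a@(active {j} a<b a′<b b≡ b<d c) = go c
      where
      input : Agrees ε e e k
      input = agrees (λ _ → ε≗e _) (λ _ → ε≗e _)

      lookup-s : ∀ (i′ : Fin n) {m} → toℕ i′ ≡ m → m ℕ.< k → lookup seq i′ ≡ s m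
      lookup-s i′ refl m<k = trans (sym (entry-lookup seq i′)) (before (current I) m<k)

      pred≡ : toℕ (pred i) ≡ 1 ℕ.+ j
      pred≡ = trans (toℕ-pred i) (cong (_∸ 1) i≡)

      pred²≡ : toℕ (pred (pred i)) ≡ j
      pred²≡ = trans (toℕ-pred (pred i)) (cong (_∸ 1) pred≡)

      j<k : j ℕ.< k
      j<k = s≤s (ℕ.n≤1+n j)

      ¬occurs-p : e j ≢ e (2 ℕ.+ j) → ¬ OccursAt p ε (pos i ∸ 2)
      ¬occurs-p a≢c o rewrite i≡ with occurs-p⇒ ε j o
      ... | a≡c , _ = a≢c (subst₂ _≡_ (ε≗e j) (ε≗e (2 ℕ.+ j)) a≡c)

      ¬occurs-q : e (1 ℕ.+ j) ≢ e (2 ℕ.+ j) → ¬ OccursAt q ε (pos i ∸ 2)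
      ¬occurs-q b≢c o rewrite i≡ with occurs-q⇒ ε j o
      ... | b≡c , _ = b≢c (subst₂ _≡_ (ε≗e (1 ℕ.+ j)) (ε≗e (2 ℕ.+ j)) b≡c)

      go : Change e s j →
        ∃[ st′ ] (step ε i ⟨ seq , last ⟩ ≡ just st′ × Invariant (suc k) st′)
      go (raise x y) =
        _ , step-p {i = i} (agrees-p {i = i} -1≤e -1≤e i≡ input (sym x , a<b , b<d))
          , invariant-write i≡ a (trans (lookup-s (pred i) pred≡ ℕ.≤-refl) (sym y)) I
      go (lower x y) =
        _ , step-q {i = i} (¬occurs-p λ a≡c → <⇒≢ a<b (trans a≡c x))
              (agrees-q {i = i} -1≤e -1≤e i≡ input (sym x , a<b , b<d))
          , invariant-write i≡ a (trans (lookup-s (pred (pred i)) pred²≡ j<k) (sym y)) I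
      -- The third input entry is `s j`, which differs from `e j` and lies below the middle entry,
      -- so neither input test succeeds; the current window begins with `s j` and matches `p`. By
      -- the invariant `last` is `e j`, so the swap cannot fail.
      go (exchange a′ a≢a′ x y) =
        _ , step-swap {i = i} (¬occurs-p λ a≡c → a≢a′ (trans a≡c x))
              (¬occurs-q λ b≡c → <⇒≢ a′<b (trans (sym (trans b≡c x)) b≡))
              (agrees-p {i = i} -1≤s -1≤e i≡ (current I)
                (sym x , a′<b , subst (_< e (3 ℕ.+ j)) b≡ b<d))
              (remembered I j<k ℕ.≤-refl a′)
          , invariant-write i≡ a (sym y) I

    algorithmA-related : ∀ {σ} → (∀ k → entry σ k ≡ s k) → algorithmA ε ≡ just σ
    algorithmA-related {σ} σ≗s
      with foldl-invariant Invariant (step ε) id (λ i → step-invariant i refl)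
             -- No index precedes 0, so a null `last` satisfies the invariant.
             {⟨ ε , nothing ⟩} (invariant (agrees (λ ()) (λ _ → ε≗e _)) λ ())
    ... | ⟨ seq , _ ⟩ , eq , I = trans (cong (Maybe.map State.seq) eq)
      (cong just (entry-injective seq σ seq≗σ))
      where
      seq≗σ : ∀ k → entry seq k ≡ entry σ k
      seq≗σ k with k ℕ.<? n
      ... | yes k<n = trans (before (current I) k<n) (sym (σ≗s k))
      ... | no k≮n  =
        trans (entry-beyond seq (ℕ.≮⇒≥ k≮n)) (sym (entry-beyond σ (ℕ.≮⇒≥ k≮n)))

-- The involution on inversion sequences

theorem4 : ∀ (n : ℕ) (ε : Vec ℤ n) → IsInversionSequence ε →
    ∃[ ε′ ] (algorithmA ε ≡ just ε′ × IsInversionSequence ε′ × algorithmA ε′ ≡ just ε)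
theorem4 n ε inv =
  ε′ , algorithmA-related R -1≤e -1≤s (λ _ → refl) ε′≗s , inv′
     , algorithmA-related (related-sym R) -1≤s -1≤e ε′≗s (λ _ → refl)
  where
  e s : Sequence
  e = entry ε
  s = transform e

  R : Related e s
  R = transform-related e

  ε′ : Vec ℤ n
  ε′ = tabulate (s ∘ toℕ)

  bounds : ∀ {m} → m ℕ.< n → (+ 0 ≤ e m) × (e m < + suc m)
  bounds m<n with inv (Fin.fromℕ< m<n)
  ... | b rewrite sym (entry-lookup ε (Fin.fromℕ< m<n)) | Fin.toℕ-fromℕ< m<n = b

  -1≤e : ∀ k → -1ℤ ≤ e k
  -1≤e k with k ℕ.<? n
  ... | yes k<n = ≤-trans -≤+ (proj₁ (bounds k<n))
  ... | no k≮n  = ≤-reflexive (sym (entry-beyond ε (ℕ.≮⇒≥ k≮n)))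

  -1≤s : ∀ k → -1ℤ ≤ s k
  -1≤s k = let m , _ , eq = output-from-input R k in subst (-1ℤ ≤_) (sym eq) (-1≤e m)

  ε′≗s : ∀ k → entry ε′ k ≡ s k
  ε′≗s k with k ℕ.<? n
  ... | yes k<n =
    subst (λ k → entry ε′ k ≡ s k) (Fin.toℕ-fromℕ< k<n)
      (trans (entry-lookup ε′ (Fin.fromℕ< k<n)) (lookup∘tabulate (s ∘ toℕ) (Fin.fromℕ< k<n)))
  ... | no k≮n with R k
  ...   | fixed k≡ _ _ =
    trans (entry-beyond ε′ (ℕ.≮⇒≥ k≮n)) (trans (sym (entry-beyond ε (ℕ.≮⇒≥ k≮n))) k≡)
  -- An active index is followed by a larger input entry, but past the end only the least value -1
  -- follows.
  ...   | changed a = contradiction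
    (subst (e k <_) (entry-beyond ε (ℕ.m≤n⇒m≤1+n (ℕ.≮⇒≥ k≮n))) (proj₁ (active-<next a)))
    (≤⇒≯ (-1≤e k))

  inv′ : IsInversionSequence ε′
  inv′ i rewrite lookup∘tabulate (s ∘ toℕ) i with output-from-input R (toℕ i)
  ... | m , m≤i , eq rewrite eq =
    let 0≤ , <1+m = bounds (ℕ.≤-<-trans m≤i (Fin.toℕ<n i))
    in 0≤ , <-≤-trans <1+m (+≤+ (s≤s m≤i))
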